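{- Let $k$ be a non-negative integer and let $R$ be either the standard or the PSD color change rule. Then there is a finite family $\mathcal G$ of graphs such that, for every graph $G$ with $|V(G)|\geq k$, one has $\operatorname{th}_R(G)\geq |V(G)|-k$ if and only if $G$ contains no member of $\mathcal G$ as an induced subgraph. (That is, the set of graphs $G$ with $\operatorname{th}_R(G)\geq |V(G)|-k$ and $|V(G)|\geq k$ is characterized by a finite family of forbidden induced subgraphs.)
   Context: All graphs are finite, simple and undirected. Vertices are blue or white. Standard color change rule: a blue vertex $u$ can force a white vertex $w$ to become blue if $w$ is the only white neighbor of $u$. PSD color change rule: if $B$ is the current set of blue vertices of $G$ and $W_1,\dots,W_m$ are the vertex sets of the connected components of $G-B$, a blue vertex $u$ can force a white vertex $w$ to become blue if, for some $i$, $w$ is the only white neighbor of $u$ in $G[B\cup W_i]$. Let $R$ be one of these rules. For $B\subseteq V(G)$ initially blue (all other vertices white), a chronological list of $R$ forces of $B$ is an ordered list of valid forces performed consecutively until no further force is possible; the set of forces in such a list is called a set of $R$ forces of $B$. For a set $\mathcal F$ of $R$ forces of $B$, let $\mathcal F^{(0)}=B$ and let $\mathcal F^{(s+1)}$ be the set of white vertices $w$ such that some $(u\to w)\in\mathcal F$ is a valid $R$ force when exactly $\bigcup_{i=0}^{s}\mathcal F^{(i)}$ is blue. Let $\operatorname{pt}_R(G;\mathcal F)$ be the least $s$ with $\bigcup_{i=0}^{s}\mathcal F^{(i)}=V(G)$ ($\infty$ if there is none), $\operatorname{pt}_R(G;B)=\min_{\mathcal F}\operatorname{pt}_R(G;\mathcal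 F)$ over all sets $\mathcal F$ of $R$ forces of $B$, and $\operatorname{th}_R(G)=\min_{B\subseteq V(G)}\big(|B|+\operatorname{pt}_R(G;B)\big)$. -}

module Defs where

open import Data.Bool using (Bool; false; T; _≟_)
open import Data.Bool.Properties using (T?)
open import Data.Fin using (Fin)
import Data.Fin.Properties as Fin
open import Data.Fin.Subset
  using (Subset; _∈_; _∉_; _∪_; ⁅_⁆; ⊤; ∣_∣)
open import Data.Fin.Subset.Properties
  using (_∈?_; anySubset?; ∈⊤; x∈⁅x⁆; x∈⁅y⁆⇒x≡y; x∈p∪q⁻; p⊆p∪q;
         q⊆p∪q; p⊂q⇒∣p∣<∣q∣; ∣p∣≤n; ∣⊤∣≡n)
open import Data.List using (List; []; _∷_)
import Data.List.Membership.Propositional as List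
import Data.List.Membership.DecPropositional as DecMembership
open import Data.Nat using (ℕ; zero; suc; _+_; _≤_; _<_; z≤n; s≤s)
import Data.Nat.Properties as ℕ
open import Data.Product using (∃; ∃-syntax; _×_; _,_; proj₁; proj₂; uncurry)
open import Data.Product.Properties using () renaming (≡-dec to ×-≡-dec)
open import Data.Sum using ([_,_]′)
open import Data.Vec using (tabulate)
open import Data.Vec.Properties
  using (lookup∘tabulate; []=⇒lookup; lookup⇒[]=)
  renaming (≡-dec to Vec-≡-dec)
open import Function using (_∘_; _⇔_; mk⇔; Equivalence; Injective)
open import Level using (0ℓ)
open import Relation.Binary.Construct.Closure.ReflexiveTransitive
  using (Star; ε; _◅_; _◅◅_)
open import Relation.Binary.PropositionalEquality
  using (_≡_; refl; sym; trans; subst)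
open import Relation.Nullary
  using (¬_; Dec; yes; no; does; contradiction; ¬?; _×-dec_; _→-dec_)
open import Relation.Nullary.Decidable using (map′; dec-true)
open import Relation.Unary using (Pred; Decidable)

record Graph : Set where
  field
    order       : ℕ
    adj         : Fin order → Fin order → Bool
    symmetric   : ∀ u v → adj u v ≡ adj v u
    irreflexive : ∀ u → adj u u ≡ false

  Vertex : Set
  Vertex = Fin order

  Adj : Vertex → Vertex → Set
  Adj u v = T (adj u v)

open Graph public using (order)

_InducedIn_ : Graph → Graph → Set
H InducedIn G =
  ∃[ f ] Injective _≡_ _≡_ f × (∀ x y → H.adj x y ≡ G.adj (f x) (f y))
  where
  module H = Graph H
  module G = Graph G

private variable
  n : ℕ

⟦_⟧ : {P : Pred (Fin n) 0ℓ} → Decidable P → Subset n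
⟦ P? ⟧ = tabulate (does ∘ P?)

∈-⟦⟧ : {P : Pred (Fin n) 0ℓ} (P? : Decidable P) → ∀ x → x ∈ ⟦ P? ⟧ ⇔ P x
∈-⟦⟧ {P = P} P? x = mk⇔ to from
  where
  to : x ∈ ⟦ P? ⟧ → P x
  to x∈ with P? x | trans (sym (lookup∘tabulate (does ∘ P?) x)) ([]=⇒lookup x∈)
  ... | yes p | _ = p
  ... | no  _ | ()
  from : P x → x ∈ ⟦ P? ⟧
  from p = lookup⇒[]= x _ (trans (lookup∘tabulate (does ∘ P?) x) (dec-true (P? x) p))

IsLeast : (ℕ → Set) → ℕ → Set
IsLeast P m = P m × (∀ k → P k → m ≤ k)

IsLeast-unique : ∀ {P a b} → IsLeast P a → IsLeast P b → a ≡ b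
IsLeast-unique (pa , la) (pb , lb) = ℕ.≤-antisym (la _ pb) (lb _ pa)

isLeast? : {P : ℕ → Set} → Decidable P → Decidable (IsLeast P)
isLeast? {P} P? m = P? m ×-dec map′ to from (¬? (ℕ.anyUpTo? P? m))
  where
  to : ¬ (∃ λ k → k < m × P k) → ∀ k → P k → m ≤ k
  to ∄ k p = ℕ.≮⇒≥ λ k<m → ∄ (k , k<m , p)
  from : (∀ k → P k → m ≤ k) → ¬ (∃ λ k → k < m × P k)
  from least (k , k<m , p) = ℕ.<⇒≱ k<m (least k p)

least : {P : ℕ → Set} → Decidable P → ∀ m → P m → ∃ (IsLeast P)
least {P} P? m p = search m 0 (ℕ.+-identityʳ m) (λ _ _ → z≤n)
  where
  search : ∀ fuel k → fuel + k ≡ m → (∀ j → P j → k ≤ j) → ∃ (IsLeast P)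
  search zero k refl below = k , p , below
  search (suc fuel) k eq below with P? k
  ... | yes pk = k , pk , below
  ... | no ¬pk = search fuel (suc k) (trans (ℕ.+-suc fuel k) eq)
                   λ j pj → ℕ.≤∧≢⇒< (below j pj) λ { refl → ¬pk pj }

data Rule : Set where
  standard psd : Rule

Force : Graph → Set
Force G = Graph.Vertex G × Graph.Vertex G

module _ (G : Graph) where
  open Graph G using (Vertex; Adj; adj)

  Adj─ : Subset (order G) → Vertex → Vertex → Set
  Adj─ B x y = x ∉ B × y ∉ B × Adj x y

  -- W is the vertex set of a connected component of G − B.
  IsComponent : Subset (order G) → Subset (order G) → Set
  IsComponent B W = ∃[ v ] v ∉ B × (∀ x → x ∈ W ⇔ Star (Adj─ B) v x)

  -- w is the only white neighbour of u in G[S] when exactly B is blue.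
  OnlyWhiteNeighbour : (B S : Subset (order G)) → Vertex → Vertex → Set
  OnlyWhiteNeighbour B S u w = WhiteNeighbour w × (∀ x → WhiteNeighbour x → x ≡ w)
    where
    WhiteNeighbour : Vertex → Set
    WhiteNeighbour x = x ∈ S × x ∉ B × Adj u x

  CanForce : Rule → Subset (order G) → Vertex → Vertex → Set
  CanForce standard B u w = u ∈ B × OnlyWhiteNeighbour B ⊤ u w
  CanForce psd      B u w =
    u ∈ B × ∃[ W ] IsComponent B W × OnlyWhiteNeighbour B (B ∪ W) u w

  -- The forces are performed one at a time, until none is possible.
  data Chronological (R : Rule) : Subset (order G) → List (Force G) → Set where
    stop  : ∀ {B} → (∀ u w → ¬ CanForce R B u w) → Chronological R B []
    force : ∀ {B u w L} → CanForce R B u w →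
            Chronological R (B ∪ ⁅ w ⁆) L → Chronological R B ((u , w) ∷ L)

  private
    B∪⁅x⁆-larger : ∀ (B : Subset (order G)) {x} → x ∉ B → ∣ B ∣ < ∣ B ∪ ⁅ x ⁆ ∣
    B∪⁅x⁆-larger B {x} x∉B =
      p⊂q⇒∣p∣<∣q∣ (p⊆p∪q _ , x , q⊆p∪q B _ (x∈⁅x⁆ x) , x∉B)

    -- Shrinks the fuel order G ∸ ∣ B ∣ of a recursion that enlarges B.
    spend : ∀ {fuel b b′} → order G ≤ suc fuel + b → b < b′ → order G ≤ fuel + b′
    spend {fuel} {b} {b′} h b<b′ = ℕ.≤-trans h
      (subst (λ m → m ≤ fuel + b′) (ℕ.+-suc fuel b) (ℕ.+-monoʳ-≤ fuel b<b′))

    spent : ∀ (B : Subset (order G)) {x} → order G ≤ ∣ B ∣ → ¬ (x ∉ B)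
    spent B h x∉B = ℕ.<⇒≱ (ℕ.<-≤-trans (B∪⁅x⁆-larger B x∉B) (∣p∣≤n (B ∪ _))) h

    adj─? : ∀ B x y → Dec (Adj─ B x y)
    adj─? B x y = ¬? (x ∈? B) ×-dec ¬? (y ∈? B) ×-dec T? (adj x y)

    module Reach (B : Subset (order G)) (v : Vertex) where

      grow : ∀ fuel S → order G ≤ fuel + ∣ S ∣ → v ∈ S →
             (∀ {x} → x ∈ S → Star (Adj─ B) v x) →
             ∃[ W ] (∀ x → x ∈ W ⇔ Star (Adj─ B) v x)
      grow fuel S h v∈S sound
        with Fin.any? (λ x → Fin.any? λ y →
               (x ∈? S) ×-dec ¬? (y ∈? S) ×-dec adj─? B x y)
      ... | no closed = S , λ x → mk⇔ sound (complete v∈S)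
        where
        complete : ∀ {x y} → x ∈ S → Star (Adj─ B) x y → y ∈ S
        complete x∈S ε = x∈S
        complete {x} x∈S (_◅_ {j = z} e es) with z ∈? S
        ... | yes z∈S = complete z∈S es
        ... | no  z∉S = contradiction (x , z , x∈S , z∉S , e) closed
      grow zero S h v∈S sound | yes (_ , _ , _ , y∉S , _) =
        contradiction y∉S (spent S h)
      grow (suc fuel) S h v∈S sound | yes (x , y , x∈S , y∉S , e) =
        grow fuel (S ∪ ⁅ y ⁆) (spend h (B∪⁅x⁆-larger S y∉S)) (p⊆p∪q _ v∈S)
          λ z∈ → [ sound , (λ z∈⁅y⁆ → subst (Star (Adj─ B) v)
                     (sym (x∈⁅y⁆⇒x≡y y z∈⁅y⁆)) (sound x∈S ◅◅ (e ◅ ε))) ]′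
                 (x∈p∪q⁻ S ⁅ y ⁆ z∈)

      reachable : ∃[ W ] (∀ x → x ∈ W ⇔ Star (Adj─ B) v x)
      reachable = grow (order G) ⁅ v ⁆ (ℕ.m≤m+n _ _) (x∈⁅x⁆ v)
        λ x∈ → subst (Star (Adj─ B) v) (sym (x∈⁅y⁆⇒x≡y v x∈)) ε

  reachable? : ∀ B v x → Dec (Star (Adj─ B) v x)
  reachable? B v x with Reach.reachable B v
  ... | W , W⇔ = map′ (Equivalence.to (W⇔ x)) (Equivalence.from (W⇔ x)) (x ∈? W)

  isComponent? : ∀ B W → Dec (IsComponent B W)
  isComponent? B W = Fin.any? λ v → ¬? (v ∈? B) ×-dec Fin.all? λ x →
    map′ (uncurry mk⇔) (λ e → Equivalence.to e , Equivalence.from e)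
      (((x ∈? W) →-dec reachable? B v x) ×-dec (reachable? B v x →-dec (x ∈? W)))

  onlyWhiteNeighbour? : ∀ B S u w → Dec (OnlyWhiteNeighbour B S u w)
  onlyWhiteNeighbour? B S u w =
    white? w ×-dec Fin.all? λ x → white? x →-dec (x Fin.≟ w)
    where
    white? : ∀ x → Dec (x ∈ S × x ∉ B × Adj u x)
    white? x = (x ∈? S) ×-dec ¬? (x ∈? B) ×-dec T? (adj u x)

  canForce? : ∀ R B u w → Dec (CanForce R B u w)
  canForce? standard B u w = (u ∈? B) ×-dec onlyWhiteNeighbour? B ⊤ u w
  canForce? psd      B u w = (u ∈? B) ×-dec anySubset? λ W →
    isComponent? B W ×-dec onlyWhiteNeighbour? B (B ∪ W) u w

  canForce⇒white : ∀ R {B u w} → CanForce R B u w → w ∉ B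
  canForce⇒white standard (_ , (_ , w∉B , _) , _) = w∉B
  canForce⇒white psd (_ , _ , _ , (_ , w∉B , _) , _) = w∉B

  _∈ᶠ?_ : (f : Force G) (F : List (Force G)) → Dec (f List.∈ F)
  _∈ᶠ?_ = DecMembership._∈?_ (×-≡-dec Fin._≟_ Fin._≟_)

  -- A set F of forces is given by a list, used only through membership.
  module _ (R : Rule) (B : Subset (order G)) (F : List (Force G)) where

    Forced : Subset (order G) → Vertex → Set
    Forced S w = ∃[ u ] (u , w) List.∈ F × CanForce R S u w

    forced? : ∀ S → Decidable (Forced S)
    forced? S w = Fin.any? λ u → ((u , w) ∈ᶠ? F) ×-dec canForce? R S u w

    -- layer s is F⁽ˢ⁾, and blueBy s is the union of layer 0, …, layer s.
    layer  : ℕ → Subset (order G)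
    blueBy : ℕ → Subset (order G)

    layer zero    = B
    layer (suc s) = ⟦ forced? (blueBy s) ⟧

    blueBy zero    = layer zero
    blueBy (suc s) = blueBy s ∪ layer (suc s)

    -- pt_R(G;F) = s; no s qualifies precisely when pt_R(G;F) = ∞.
    IsPtOfForces : ℕ → Set
    IsPtOfForces = IsLeast (λ s → blueBy s ≡ ⊤)

  -- pt_R(G;B) = s; no s qualifies precisely when pt_R(G;B) = ∞.
  IsPt : Rule → Subset (order G) → ℕ → Set
  IsPt R B = IsLeast (λ s → ∃[ F ] Chronological R B F × IsPtOfForces R B F s)

  -- th_R(G) = t. Infinite values of pt_R(G;B) can be left out of the minimum,
  -- as B = V(G) contributes a finite one.
  IsThrottling : Rule → ℕ → Set
  IsThrottling R =
    IsLeast (λ t → ∃[ B ] ∃[ s ] IsPt R B s × ∣ B ∣ + s ≡ t)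

  private
    subset-≟ : (p q : Subset (order G)) → Dec (p ≡ q)
    subset-≟ = Vec-≡-dec _≟_

    chronological? : ∀ R {Q : List (Force G) → Set} → Decidable Q →
      ∀ fuel B → order G ≤ fuel + ∣ B ∣ → Dec (∃[ F ] Chronological R B F × Q F)
    chronological? R {Q} Q? fuel B h
      with Fin.any? (λ u → Fin.any? λ w → canForce? R B u w)
    ... | no stuck = map′
            (λ q → [] , stop (λ u w c → stuck (u , w , c)) , q)
            (λ { ([] , stop _ , q) → q
               ; (_ , force c _ , _) → contradiction (_ , _ , c) stuck })
            (Q? [])
    chronological? R Q? zero B h | yes (_ , _ , c) =
      contradiction (canForce⇒white R c) (spent B h)
    chronological? R {Q} Q? (suc fuel) B h | yes (u₀ , w₀ , c₀) = map′
      (λ { (u , w , c , F , L , q) → (u , w) ∷ F , force c L , q })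
      (λ { ([] , stop stuck , _) → contradiction c₀ (stuck u₀ w₀)
         ; ((u , w) ∷ F , force c L , q) → u , w , c , F , L , q })
      (Fin.any? λ u → Fin.any? λ w → first? u w)
      where
      first? : ∀ u w → Dec (CanForce R B u w ×
        ∃[ F ] Chronological R (B ∪ ⁅ w ⁆) F × Q ((u , w) ∷ F))
      first? u w with canForce? R B u w
      ... | no ¬c = no (¬c ∘ proj₁)
      ... | yes c = map′ (c ,_) proj₂
        (chronological? R (Q? ∘ ((u , w) ∷_)) fuel (B ∪ ⁅ w ⁆)
          (spend h (B∪⁅x⁆-larger B (canForce⇒white R c))))

    isPt? : ∀ R B → Decidable (IsPt R B)
    isPt? R B = isLeast? λ s → chronological? R
      (λ F → isLeast? (λ s → subset-≟ (blueBy R B F s) ⊤) s)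
      (order G) B (ℕ.m≤m+n _ _)

    attained? : ∀ R → Decidable (λ t → ∃[ B ] ∃[ s ] IsPt R B s × ∣ B ∣ + s ≡ t)
    attained? R t = anySubset? λ B → map′
      (λ { (s , _ , pt , eq) → s , pt , eq })
      (λ { (s , pt , eq) → s , s≤s (subst (s ≤_) eq (ℕ.m≤n+m s ∣ B ∣)) , pt , eq })
      (ℕ.anyUpTo? (λ s → isPt? R B s ×-dec (∣ B ∣ + s ℕ.≟ t)) (suc t))

    pt-⊤ : ∀ R → IsPt R ⊤ 0
    pt-⊤ R = ([] , stop (λ u w c → canForce⇒white R c ∈⊤) , refl , λ _ _ → z≤n)
           , λ _ _ → z≤n

  abstract
    throttling-exists : ∀ R → ∃ (IsThrottling R)
    throttling-exists R =
      least (attained? R) (order G)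
        (⊤ , 0 , pt-⊤ R , trans (ℕ.+-identityʳ _) (∣⊤∣≡n _))

th : Rule → Graph → ℕ
th R G = proj₁ (throttling-exists G R)

th-isThrottling : ∀ R G → IsThrottling G R (th R G)
th-isThrottling R G = proj₂ (throttling-exists G R)

-- Reading off the layers of a fast propagation, th(G) ≤ |V(G)| - e holds iff G has a
-- schedule of simultaneous forces whose targets outnumber its time steps by at least e.
-- Colouring further vertices blue keeps forces valid, so forces may be dropped from a
-- schedule, and so may layers that become empty; blue vertices that force nothing can be
-- deleted from G or added to it. A saving of e is thus already realised by at most 2e
-- forces, hence by an induced subgraph on their at most 4e endpoints, and conversely it
-- passes from induced subgraphs to G. With e = k + 1, the graphs of order at most
-- 4(k + 1) with th(H) ≤ |V(H)| - e form the forbidden family.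
module Submission where

open import Defs
open import Data.Bool using (Bool; true; false; T; _∧_; _∨_; not)
import Data.Bool.Properties as Bool
open import Data.Fin using (Fin; zero; suc)
import Data.Fin.Properties as Fin
open import Data.Fin.Subset using (Subset; _∈_; _∉_; _∪_; ⁅_⁆; ⊤; ∣_∣)
open import Data.Fin.Subset.Properties
  using (_∈?_; ∈⊤; x∈⁅x⁆; x∈⁅y⁆⇒x≡y; x∈p∪q⁻; p⊆p∪q; q⊆p∪q; p⊂q⇒∣p∣<∣q∣;
         ∣p∣≤n; ∣⊤∣≡n; p⊆q⇒∣p∣≤∣q∣; ∪-identityʳ; ⊆-antisym; ⊆-max)
open import Data.List
  using (List; []; _∷_; _++_; map; concat; concatMap; length; take; filter;
         deduplicate; allFin; upTo; lookup; cartesianProductWith)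
open import Data.List.Properties
  using (length-map; length-++; length-take; ++-identityʳ; concat-map; map-++; map-∘;
         length-deduplicate)
open import Data.List.Membership.Propositional as List using (find; lose)
import Data.List.Membership.DecPropositional as ListDec
open import Data.List.Membership.Propositional.Properties
  using (∈-map⁺; ∈-map⁻; ∈-++⁺ˡ; ∈-++⁺ʳ; ∈-++⁻; ∈-filter⁺; ∈-filter⁻; ∈-allFin; ∈-upTo⁺;
         ∈-concatMap⁺; ∈-deduplicate⁺; ∈-lookup; ∈-cartesianProductWith⁺)
open import Data.List.Relation.Binary.Sublist.Propositional as Sublist
  using ([]; _∷_; _∷ʳ_) renaming (_⊆_ to _⊆ˢ_)
import Data.List.Relation.Binary.Sublist.Propositional.Properties as Sublist
open import Data.List.Relation.Unary.All as All using (All; []; _∷_)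
import Data.List.Relation.Unary.All.Properties as All
open import Data.List.Relation.Unary.AllPairs using ([]; _∷_)
open import Data.List.Relation.Unary.Any as Any using (Any; here; there)
import Data.List.Relation.Unary.Any.Properties as Any
open import Data.List.Relation.Unary.Unique.Propositional using (Unique)
import Data.List.Relation.Unary.Unique.Propositional.Properties as Unique
open import Data.List.Relation.Unary.Unique.DecPropositional.Properties using (deduplicate-!)
open import Data.Nat using (ℕ; zero; suc; _+_; _≤_; _<_; _≥_; _∸_; z≤n; s≤s; s≤s⁻¹; _≤?_)
import Data.Nat.Properties as ℕ
open import Data.Nat.Solver using (module +-*-Solver)
open import Data.Nat.Induction using (<-rec)
open import Data.Product using (∃; ∃-syntax; Σ-syntax; _×_; _,_; proj₁; proj₂)
  renaming (map to map×)
open import Data.Sum as Sum using (_⊎_; inj₁; inj₂; [_,_]′)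
open import Data.Unit using (tt) renaming (⊤ to Unit)
open import Data.Vec as Vec using (Vec; []; _∷_)
import Data.Vec.Properties as Vec
open import Function using (_⇔_; mk⇔; Equivalence; Injective; id; _∘_; case_of_)
open import Relation.Binary.Construct.Closure.ReflexiveTransitive
  using (Star; ε; _◅_; _◅◅_; gmap)
open import Relation.Binary.PropositionalEquality
  using (_≡_; refl; sym; trans; cong; cong₂; subst; subst₂)
open import Relation.Nullary using (¬_; yes; no; contradiction; ¬?; _×-dec_)
open import Relation.Nullary.Decidable using (decidable-stable)

-- Lists, finite subsets and least elements.

module _ {A : Set} where

  unmap : ∀ {B : Set} (g : A → B) {ys} →
    All (λ y → ∃[ x ] g x ≡ y) ys → ∃[ xs ] map g xs ≡ ys
  unmap g [] = [] , refl
  unmap g ((x , refl) ∷ ps) with xs , refl ← unmap g ps = x ∷ xs , refl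

  Unique-resp-⊆ : {xs ys : List A} → xs ⊆ˢ ys → Unique ys → Unique xs
  Unique-resp-⊆ [] u = u
  Unique-resp-⊆ (_ ∷ʳ s) (_ ∷ u) = Unique-resp-⊆ s u
  Unique-resp-⊆ (refl ∷ s) (p ∷ u) = Sublist.All-resp-⊆ s p ∷ Unique-resp-⊆ s u

  lookup-injective : {xs : List A} → Unique xs → Injective _≡_ _≡_ (lookup xs)
  lookup-injective (_ ∷ _) {zero} {zero} _ = refl
  lookup-injective (p ∷ _) {zero} {suc j} eq =
    contradiction eq (All.lookup p (∈-lookup j))
  lookup-injective (p ∷ _) {suc i} {zero} eq =
    contradiction (sym eq) (All.lookup p (∈-lookup i))
  lookup-injective (_ ∷ u) {suc i} {suc j} eq = cong suc (lookup-injective u eq)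

  vectors : List A → ∀ m → List (Vec A m)
  vectors xs zero = [] ∷ []
  vectors xs (suc m) = cartesianProductWith _∷_ xs (vectors xs m)

  ∈-vectors : ∀ {xs} → (∀ x → x List.∈ xs) → ∀ {m} (v : Vec A m) → v List.∈ vectors xs m
  ∈-vectors all [] = here refl
  ∈-vectors all (x ∷ v) = ∈-cartesianProductWith⁺ _∷_ (all x) (∈-vectors all v)

∣p∪⁅x⁆∣≤1+∣p∣ : ∀ {n} (p : Subset n) x → ∣ p ∪ ⁅ x ⁆ ∣ ≤ suc ∣ p ∣
∣p∪⁅x⁆∣≤1+∣p∣ (false ∷ p) zero = s≤s (ℕ.≤-reflexive (cong ∣_∣ (∪-identityʳ p)))
∣p∪⁅x⁆∣≤1+∣p∣ (true  ∷ p) zero = s≤s (ℕ.m≤n⇒m≤1+n (ℕ.≤-reflexive (cong ∣_∣ (∪-identityʳ p))))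
∣p∪⁅x⁆∣≤1+∣p∣ (false ∷ p) (suc x) = ∣p∪⁅x⁆∣≤1+∣p∣ p x
∣p∪⁅x⁆∣≤1+∣p∣ (true  ∷ p) (suc x) = s≤s (∣p∪⁅x⁆∣≤1+∣p∣ p x)

module _ {n : ℕ} where

  -- Indexing into the deduplicated list is injective; this numbers a set of vertices as the vertex
  -- set of an induced subgraph.
  injective-cover : (xs : List (Fin n)) → ∃[ m ] m ≤ length xs × Σ[ f ∈ (Fin m → Fin n) ]
    Injective _≡_ _≡_ f × (∀ {x} → x List.∈ xs → ∃[ i ] f i ≡ x)
  injective-cover xs =
    length ys , length-deduplicate Fin._≟_ xs , lookup ys ,
    lookup-injective (deduplicate-! Fin._≟_ xs) ,
    λ x∈xs → let x∈ys = ∈-deduplicate⁺ Fin._≟_ x∈xs in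
      Any.index x∈ys , sym (Any.lookup-index x∈ys)
    where ys = deduplicate Fin._≟_ xs

  ∪⁅⁆-cases : ∀ (p : Subset n) {x y} → y ∈ p ∪ ⁅ x ⁆ → y ∈ p ⊎ y ≡ x
  ∪⁅⁆-cases p {x} y∈ = Sum.map₂ (x∈⁅y⁆⇒x≡y x) (x∈p∪q⁻ p ⁅ x ⁆ y∈)

  n≤∣p∣+length : ∀ (p : Subset n) xs → (∀ {x} → x ∉ p → x List.∈ xs) → n ≤ ∣ p ∣ + length xs
  n≤∣p∣+length p [] cover = ℕ.≤-trans (ℕ.≤-reflexive (sym (∣⊤∣≡n n)))
    (ℕ.≤-trans (p⊆q⇒∣p∣≤∣q∣ {p = ⊤} λ {x} _ →
      decidable-stable (x ∈? p) λ x∉p → case cover x∉p of λ ()) (ℕ.m≤m+n _ _))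
  n≤∣p∣+length p (x ∷ xs) cover = begin
    n                            ≤⟨ n≤∣p∣+length (p ∪ ⁅ x ⁆) xs cover′ ⟩
    ∣ p ∪ ⁅ x ⁆ ∣ + length xs    ≤⟨ ℕ.+-monoˡ-≤ (length xs) (∣p∪⁅x⁆∣≤1+∣p∣ p x) ⟩
    suc ∣ p ∣ + length xs        ≡⟨ ℕ.+-suc ∣ p ∣ (length xs) ⟨
    ∣ p ∣ + suc (length xs)      ∎
    where
    open ℕ.≤-Reasoning
    cover′ : ∀ {y} → y ∉ p ∪ ⁅ x ⁆ → y List.∈ xs
    cover′ y∉ with cover (y∉ ∘ p⊆p∪q ⁅ x ⁆)
    ... | here refl = contradiction (q⊆p∪q p ⁅ x ⁆ (x∈⁅x⁆ x)) y∉
    ... | there y∈ = y∈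

  ∣p∣+length≤n : ∀ (p : Subset n) {xs} → Unique xs → (∀ {x} → x List.∈ xs → x ∉ p) →
    ∣ p ∣ + length xs ≤ n
  ∣p∣+length≤n p [] _ = subst (_≤ n) (sym (ℕ.+-identityʳ ∣ p ∣)) (∣p∣≤n p)
  ∣p∣+length≤n p {x ∷ xs} (x∉xs ∷ u) disjoint = begin
    ∣ p ∣ + suc (length xs)    ≡⟨ ℕ.+-suc ∣ p ∣ (length xs) ⟩
    suc ∣ p ∣ + length xs      ≤⟨ ℕ.+-monoˡ-≤ (length xs) (p⊂q⇒∣p∣<∣q∣
                                    (p⊆p∪q _ , x , q⊆p∪q p _ (x∈⁅x⁆ x) , disjoint (here refl))) ⟩
    ∣ p ∪ ⁅ x ⁆ ∣ + length xs  ≤⟨ ∣p∣+length≤n (p ∪ ⁅ x ⁆) u disjoint′ ⟩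
    n                          ∎
    where
    open ℕ.≤-Reasoning
    disjoint′ : ∀ {y} → y List.∈ xs → y ∉ p ∪ ⁅ x ⁆
    disjoint′ y∈xs y∈ with ∪⁅⁆-cases p y∈
    ... | inj₁ y∈p = disjoint (there y∈xs) y∈p
    ... | inj₂ refl = All.lookup x∉xs y∈xs refl

-- For an undecided `P` the minimum is obtained only under double negation, which suffices when the
-- goal is a decidable inequality.
¬¬-least : {P : ℕ → Set} → ∀ m → P m → ¬ ¬ ∃ (IsLeast P)
¬¬-least {P} m p ∄ = <-rec (λ m → ¬ P m)
  (λ m below p → ∄ (m , p , λ j pj → ℕ.≮⇒≥ λ j<m → below j<m pj)) m p

-- Forces in terms of the white vertices, and schedules.

module _ (G : Graph) where
  open Graph G using (Vertex; Adj)

  -- When exactly W is white: whether a white neighbour x prevents forcing w.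
  Linked : Rule → (Vertex → Set) → Vertex → Vertex → Set
  Linked standard W w x = Unit
  Linked psd W = Star λ x y → W x × W y × Adj x y

  -- `W` is an arbitrary predicate, so the targets of a schedule can serve as the white set. For
  -- `psd`, the component of `w` appears as reachability from `w` through white vertices.
  record Forces (R : Rule) (W : Vertex → Set) (u w : Vertex) : Set where
    field
      blue     : ¬ W u
      white    : W w
      adjacent : Adj u w
      only     : ∀ {x} → W x → Adj u x → Linked R W w x → x ≡ w

  -- With `_∉ B` as white set, the paths in `Linked psd` are those of `Adj─ B`; a path from the root
  -- of the component to `w` extends to `x`.
  CanForce⇒Forces : ∀ R {B u w} → CanForce G R B u w → Forces R (_∉ B) u w
  CanForce⇒Forces standard (u∈B , (_ , w∉B , uw) , only) = record
    { blue = λ u∉B → u∉B u∈B ; white = w∉B ; adjacent = uw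
    ; only = λ x∉B ux _ → only _ (∈⊤ , x∉B , ux) }
  CanForce⇒Forces psd {B} (u∈B , W , (_ , _ , W⇔) , (w∈ , w∉B , uw) , only) = record
    { blue = λ u∉B → u∉B u∈B ; white = w∉B ; adjacent = uw
    ; only = λ {x} x∉B ux wx → only x
        (q⊆p∪q B W (Equivalence.from (W⇔ x) (Equivalence.to (W⇔ _) w∈W ◅◅ wx)) , x∉B , ux) }
    where
    w∈W = [ (λ w∈B → contradiction w∈B w∉B) , id ]′ (x∈p∪q⁻ B W w∈)

  Forces⇒CanForce : ∀ R {B u w} → Forces R (_∉ B) u w → CanForce G R B u w
  Forces⇒CanForce standard {B} {u} F =
    decidable-stable (u ∈? B) blue , (∈⊤ , white , adjacent) ,
    λ x (_ , x∉B , ux) → only x∉B ux tt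
    where open Forces F
  Forces⇒CanForce psd {B} {u} {w} F =
    decidable-stable (u ∈? B) blue , W , (w , white , W⇔) ,
    (q⊆p∪q B W (Equivalence.from (W⇔ w) ε) , white , adjacent) ,
    λ x (x∈ , x∉B , ux) → only x∉B ux
      ([ (λ x∈B → contradiction x∈B x∉B) , Equivalence.to (W⇔ x) ]′ (x∈p∪q⁻ B W x∈))
    where
    open Forces F
    W = ⟦ reachable? G B w ⟧
    W⇔ = ∈-⟦⟧ (reachable? G B w)

  whites : List (List (Force G)) → List Vertex
  whites Ls = map proj₂ (concat Ls)

  -- The i-th layer lists the forces performed simultaneously in step i; initially
  -- the white vertices are exactly the targets of all the layers.
  data Schedule (R : Rule) : List (List (Force G)) → Set where
    []  : Schedule R []
    _∷_ : ∀ {L Ls} → All (λ (u , w) → Forces R (List._∈ whites (L ∷ Ls)) u w) L →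
          Schedule R Ls → Schedule R (L ∷ Ls)

  -- By `unique`, the number of forces equals the number of initially white vertices, so `saving`
  -- compares that number with the number of time steps.
  record EfficientSchedule (R : Rule) (e : ℕ) : Set where
    field
      layers   : List (List (Force G))
      schedule : Schedule R layers
      unique   : Unique (whites layers)
      saving   : length layers + e ≤ length (concat layers)

-- Transport of forces and schedules along an induced embedding.

module _ {H G : Graph} (R : Rule) {f : Graph.Vertex H → Graph.Vertex G}
         (f-injective : Injective _≡_ _≡_ f)
         (f-adj : ∀ x y → Graph.adj H x y ≡ Graph.adj G (f x) (f y)) where

  private
    module H = Graph H
    module G = Graph G

    push : ∀ {x y} → H.Adj x y → G.Adj (f x) (f y)
    push = subst T (f-adj _ _)

    pull : ∀ {x y} → G.Adj (f x) (f y) → H.Adj x y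
    pull = subst T (sym (f-adj _ _))

  -- Competing white neighbours and white paths in `H` map to such in `G`, where `only` applies;
  -- injectivity brings the equality back.
  Forces-restrict : ∀ {WH WG u w} → (∀ {x} → WH x → WG (f x)) → WH w →
    Forces G R WG (f u) (f w) → Forces H R WH u w
  Forces-restrict {WH} {WG} WH⊆WG w∈ F = record
    { blue = blue ∘ WH⊆WG ; white = w∈ ; adjacent = pull adjacent
    ; only = λ x∈ ux l → f-injective (only (WH⊆WG x∈) (push ux) (link R l)) }
    where
    open Forces F
    link : ∀ R {w x} → Linked H R WH w x → Linked G R WG (f w) (f x)
    link standard _ = tt
    link psd = gmap f λ (x∈ , y∈ , xy) → WH⊆WG x∈ , WH⊆WG y∈ , push xy

  -- Every vertex of `G` outside the image is blue, so each competitor of `f w` and each white path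
  -- to it already lives in `H`.
  Forces-extend : ∀ {WH WG u w} → (∀ {y} → WG y → ∃[ x ] WH x × y ≡ f x) → WG (f w) →
    Forces H R WH u w → Forces G R WG (f u) (f w)
  Forces-extend {WH} {WG} image w∈ F = record
    { blue = λ fu∈ → blue (preimage fu∈) ; white = w∈ ; adjacent = push adjacent
    ; only = only′ }
    where
    open Forces F
    preimage : ∀ {x} → WG (f x) → WH x
    preimage fx∈ with _ , x∈ , eq ← image fx∈ = subst WH (sym (f-injective eq)) x∈
    link : ∀ R {w x} → Linked G R WG (f w) (f x) → Linked H R WH w x
    link standard _ = tt
    link psd = go refl
      where
      -- The endpoint is a variable `y` with an equation, so that the path can be matched on.
      go : ∀ {w x y} → y ≡ f x → Star (λ x y → WG x × WG y × G.Adj x y) (f w) y →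
        Star (λ x y → WH x × WH y × H.Adj x y) w x
      go eq ε rewrite f-injective eq = ε
      go eq ((a∈ , b∈ , ab) ◅ s) with _ , b∈′ , refl ← image b∈ =
        (preimage a∈ , b∈′ , pull ab) ◅ go eq s
    only′ : ∀ {y} → WG y → G.Adj (f _) y → Linked G R WG (f _) y → y ≡ f _
    only′ y∈ uy l with _ , x∈ , refl ← image y∈ = cong f (only x∈ (pull uy) (link R l))

  private
    mapLayers : List (List (Force H)) → List (List (Force G))
    mapLayers = map (map (map× f f))

    concat-mapLayers : ∀ Ls → concat (mapLayers Ls) ≡ map (map× f f) (concat Ls)
    concat-mapLayers Ls = concat-map Ls

    whites-mapLayers : ∀ Ls → whites G (mapLayers Ls) ≡ map f (whites H Ls)
    whites-mapLayers Ls = trans (cong (map proj₂) (concat-mapLayers Ls))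
      (trans (sym (map-∘ (concat Ls))) (map-∘ (concat Ls)))

    length-concat-mapLayers : ∀ Ls → length (concat (mapLayers Ls)) ≡ length (concat Ls)
    length-concat-mapLayers Ls =
      trans (cong length (concat-mapLayers Ls)) (length-map (map× f f) (concat Ls))

    ∈-whites⁺ : ∀ Ls {x} → x List.∈ whites H Ls → f x List.∈ whites G (mapLayers Ls)
    ∈-whites⁺ Ls x∈ = subst (f _ List.∈_) (sym (whites-mapLayers Ls)) (∈-map⁺ f x∈)

    ∈-whites⁻ : ∀ Ls {y} → y List.∈ whites G (mapLayers Ls) →
      ∃[ x ] x List.∈ whites H Ls × y ≡ f x
    ∈-whites⁻ Ls y∈ = ∈-map⁻ f (subst (_ List.∈_) (whites-mapLayers Ls) y∈)

  Schedule-extend : ∀ {Ls} → Schedule H R Ls → Schedule G R (mapLayers Ls)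
  Schedule-extend [] = []
  Schedule-extend {L ∷ Ls} (F ∷ s) = All.map⁺ (All.map
    (λ φ → Forces-extend (∈-whites⁻ (L ∷ Ls)) (∈-whites⁺ (L ∷ Ls) (Forces.white φ)) φ) F)
    ∷ Schedule-extend s

  Schedule-restrict : ∀ Ls → Schedule G R (mapLayers Ls) → Schedule H R Ls
  Schedule-restrict [] [] = []
  Schedule-restrict (L ∷ Ls) (F ∷ s) = All.tabulate
    (λ φ∈ → Forces-restrict (∈-whites⁺ (L ∷ Ls)) (∈-map⁺ proj₂ (∈-++⁺ˡ φ∈))
      (All.lookup (All.map⁻ F) φ∈))
    ∷ Schedule-restrict Ls s

  EfficientSchedule-extend : ∀ {e} → EfficientSchedule H R e → EfficientSchedule G R e
  EfficientSchedule-extend {e} E = record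
    { layers = mapLayers layers
    ; schedule = Schedule-extend schedule
    ; unique = subst Unique (sym (whites-mapLayers layers)) (Unique.map⁺ f-injective unique)
    ; saving = subst₂ (λ l m → l + e ≤ m) (sym (length-map _ layers))
        (sym (length-concat-mapLayers layers)) saving }
    where open EfficientSchedule E

  EfficientSchedule-restrict : ∀ {e} (E : EfficientSchedule G R e) →
    (∀ {u w} → (u , w) List.∈ concat (EfficientSchedule.layers E) →
      (∃[ x ] f x ≡ u) × (∃[ y ] f y ≡ w)) →
    EfficientSchedule H R e
  EfficientSchedule-restrict {e}
    record { layers = Ms ; schedule = s ; unique = uniq ; saving = saving } endpoints
    -- All endpoints lie in the image of `f`, so `Ms` is literally `mapLayers Ls` for some layers
    -- `Ls` of `H`.
    with Ls , refl ← unmap (map (map× f f)) (All.map (unmap (map× f f))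
           (All.concat⁻ {xss = Ms} (All.tabulate λ φ∈ →
             let (x , fx) , (y , fy) = endpoints φ∈ in (x , y) , cong₂ _,_ fx fy))) = record
    { layers = Ls
    ; schedule = Schedule-restrict Ls s
    ; unique = Unique.map⁻ (subst Unique (whites-mapLayers Ls) uniq)
    ; saving = subst₂ (λ l m → l + e ≤ m) (length-map _ Ls)
        (length-concat-mapLayers Ls) saving }

-- Thinning a schedule and passing to a small induced subgraph.

module _ {G : Graph} {R : Rule} where
  open Graph G using (Vertex; Adj)

  -- The identity embedding in `Forces-restrict`: a smaller white set has fewer competitors and
  -- fewer white paths.
  Forces-mono : ∀ {W W′ : Vertex → Set} {u w} → (∀ {x} → W x → W′ x) → W w →
    Forces G R W′ u w → Forces G R W u w
  Forces-mono = Forces-restrict {G} {G} R id λ _ _ → refl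

  whites-mono : ∀ {Ls Ms : List (List (Force G))} → concat Ms ⊆ˢ concat Ls →
    ∀ {x} → x List.∈ whites G Ms → x List.∈ whites G Ls
  whites-mono Ms⊆Ls = Sublist.Any-resp-⊆ (Sublist.map⁺ proj₂ Ms⊆Ls)

  -- The target of a dropped force counts as blue from the start, so the white set only shrinks.
  Schedule-thin : ∀ {L Ls M Ms} → M ⊆ˢ L → concat Ms ⊆ˢ concat Ls →
    Schedule G R (L ∷ Ls) → Schedule G R Ms → Schedule G R (M ∷ Ms)
  Schedule-thin {L} {Ls} {M} {Ms} M⊆L Ms⊆Ls (F ∷ _) s = All.tabulate
    (λ φ∈ → Forces-mono (whites-mono {L ∷ Ls} {M ∷ Ms} (Sublist.++⁺ M⊆L Ms⊆Ls))
      (∈-map⁺ proj₂ (∈-++⁺ˡ φ∈)) (All.lookup F (Sublist.Any-resp-⊆ M⊆L φ∈))) ∷ s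

  private
    open +-*-Solver using (solve; con; _:+_; _:=_)

    regroup : ∀ ℓ c d → suc ℓ + suc (c + d) ≡ 2 + c + (ℓ + d)
    regroup = solve 3 (λ ℓ c d → con 1 :+ ℓ :+ (con 1 :+ (c :+ d)) := con 2 :+ c :+ (ℓ :+ d)) refl
    double : ∀ c d → 2 + c + (d + d) + c ≡ suc (c + d) + suc (c + d)
    double = solve 2 (λ c d → con 2 :+ c :+ (d :+ d) :+ c :=
                              con 1 :+ (c :+ d) :+ (con 1 :+ (c :+ d))) refl

  -- Layers with at most one force save nothing; a layer of c ≥ 2 forces saves
  -- c - 1 ≥ c / 2, so few forces already give the saving e.
  thin-out : ∀ e {Ls} → Schedule G R Ls → length Ls + e ≤ length (concat Ls) →
    ∃[ Ms ] Schedule G R Ms × concat Ms ⊆ˢ concat Ls ×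
            length Ms + e ≤ length (concat Ms) × length (concat Ms) ≤ e + e
  thin-out zero s h = [] , [] , Sublist.minimum _ , z≤n , z≤n
  thin-out (suc e) {[] ∷ Ls} (_ ∷ s) h = thin-out (suc e) s (ℕ.<⇒≤ h)
  -- Dropping this layer loses one force and one time step, which cancel.
  thin-out (suc e) {(φ ∷ []) ∷ Ls} (_ ∷ s) h
    with Ms , s′ , sub , bounds ← thin-out (suc e) s (s≤s⁻¹ h) = Ms , s′ , φ ∷ʳ sub , bounds
  thin-out (suc e) {L@(_ ∷ _ ∷ L′) ∷ Ls} s@(_ ∷ s′) h with ℕ.≤-total e (length L′)
  -- One layer of `2 + e` forces already saves `suc e`, so everything else is dropped.
  ... | inj₁ e≤ = M ∷ [] , Schedule-thin (Sublist.take-⊆ (2 + e) L) (Sublist.minimum _) s [] ,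
        Sublist.++⁺ (Sublist.take-⊆ (2 + e) L) (Sublist.minimum _) ,
        ℕ.≤-reflexive (sym length-M) ,
        ℕ.≤-trans (ℕ.≤-reflexive length-M) (s≤s (ℕ.m≤n+m (suc e) e))
    where
    M = take (2 + e) L
    length-M : length (M ++ []) ≡ 2 + e
    length-M = trans (cong length (++-identityʳ M))
      (trans (length-take (2 + e) L) (ℕ.m≤n⇒m⊓n≡m (s≤s (s≤s e≤))))
  -- Write `c` for `length L′`. The whole layer saves `1 + c`, so the later layers still have to
  -- save `d`, where `c + d` is `e`. They use at most `2d` forces, and `(2 + c) + 2d` is at most
  -- `2(1 + c + d)`.
  ... | inj₂ c≤e with d , refl ← ℕ.m≤n⇒∃[o]m+o≡n c≤e
    with Ms , t , sub , saving , small ← thin-out d s′ (ℕ.+-cancelˡ-≤ (2 + length L′) _ _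
           (subst (_≤ 2 + length L′ + length (concat Ls)) (regroup (length Ls) (length L′) d)
             (subst (suc (length Ls) + suc (length L′ + d) ≤_) (length-++ L) h))) =
    L ∷ Ms , Schedule-thin Sublist.⊆-refl sub s t , Sublist.++⁺ Sublist.⊆-refl sub ,
    (begin
      suc (length Ms) + suc (length L′ + d)   ≡⟨ regroup (length Ms) (length L′) d ⟩
      2 + length L′ + (length Ms + d)         ≤⟨ ℕ.+-monoʳ-≤ (2 + length L′) saving ⟩
      2 + length L′ + length (concat Ms)      ≡⟨ length-++ L ⟨
      length (L ++ concat Ms)                 ∎) ,
    (begin
      length (L ++ concat Ms)                 ≡⟨ length-++ L ⟩
      2 + length L′ + length (concat Ms)      ≤⟨ ℕ.+-monoʳ-≤ (2 + length L′) small ⟩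
      2 + length L′ + (d + d)                 ≤⟨ ℕ.m≤m+n _ (length L′) ⟩
      2 + length L′ + (d + d) + length L′     ≡⟨ double (length L′) d ⟩
      suc (length L′ + d) + suc (length L′ + d) ∎)
    where
    open ℕ.≤-Reasoning

  -- After thinning, at most `e + e` forces remain; `H` is induced on their sources and targets.
  small-support : ∀ {e} → EfficientSchedule G R e →
    ∃[ H ] order H ≤ (e + e) + (e + e) × H InducedIn G × EfficientSchedule H R e
  small-support {e} record { schedule = s₀ ; unique = unique ; saving = saving₀ }
    with Ms , s , sub , saving , small ← thin-out e s₀ saving₀
    with m , m≤ , f , f-injective , cover ←
           injective-cover (map proj₁ (concat Ms) ++ map proj₂ (concat Ms)) =
    H , bound , (f , f-injective , λ _ _ → refl) ,
    EfficientSchedule-restrict {H} {G} R f-injective (λ _ _ → refl)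
      (record { layers = Ms ; schedule = s ; saving = saving
              ; unique = Unique-resp-⊆ (Sublist.map⁺ proj₂ sub) unique })
      (λ φ∈ → cover (∈-++⁺ˡ (∈-map⁺ proj₁ φ∈)) , cover (∈-++⁺ʳ _ (∈-map⁺ proj₂ φ∈)))
    where
    H : Graph
    H = record
      { order = m ; adj = λ x y → Graph.adj G (f x) (f y)
      ; symmetric = λ x y → Graph.symmetric G (f x) (f y)
      ; irreflexive = λ x → Graph.irreflexive G (f x) }
    bound : m ≤ (e + e) + (e + e)
    bound = ℕ.≤-trans m≤ (subst (_≤ (e + e) + (e + e)) (sym (length-++ (map proj₁ (concat Ms))))
      (ℕ.+-mono-≤ (subst (_≤ e + e) (sym (length-map proj₁ (concat Ms))) small)
                  (subst (_≤ e + e) (sym (length-map proj₂ (concat Ms))) small)))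

  -- From schedules to throttling numbers.

  -- Forces of one layer may be performed one after another: the white set shrinks, and uniqueness
  -- keeps the later targets white. The list ends when no vertex is white.
  Schedule⇒Chronological : ∀ {Ls} → Schedule G R Ls → Unique (whites G Ls) →
    ∀ {B} → (∀ x → x ∉ B ⇔ x List.∈ whites G Ls) → Chronological G R B (concat Ls)
  Schedule⇒Chronological [] _ white = stop λ u w c →
    case Equivalence.to (white w) (canForce⇒white G R c) of λ ()
  Schedule⇒Chronological {L ∷ Ls} (F ∷ s) = go L F id
    where
    go : ∀ M → All (λ (u , w) → Forces G R (List._∈ whites G (L ∷ Ls)) u w) M →
      (∀ {x} → x List.∈ whites G (M ∷ Ls) → x List.∈ whites G (L ∷ Ls)) →
      Unique (whites G (M ∷ Ls)) →
      ∀ {B} → (∀ x → x ∉ B ⇔ x List.∈ whites G (M ∷ Ls)) → Chronological G R B (M ++ concat Ls)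
    go [] _ _ unique white = Schedule⇒Chronological s unique white
    go ((u , w) ∷ M) (φ ∷ F) sub (w∉ ∷ unique) {B} white = force
      (Forces⇒CanForce G R (Forces-mono (sub ∘ Equivalence.to (white _))
        (Equivalence.from (white w) (here refl)) φ))
      (go M F (sub ∘ there) unique λ x → mk⇔ (to x) (from x))
      where
      to : ∀ x → x ∉ B ∪ ⁅ w ⁆ → x List.∈ whites G (M ∷ Ls)
      to x x∉ with Equivalence.to (white x) (x∉ ∘ p⊆p∪q ⁅ w ⁆)
      ... | here refl = contradiction (q⊆p∪q B ⁅ w ⁆ (x∈⁅x⁆ w)) x∉
      ... | there x∈ = x∈
      from : ∀ x → x List.∈ whites G (M ∷ Ls) → x ∉ B ∪ ⁅ w ⁆
      from x x∈ x∈B∪ with ∪⁅⁆-cases B x∈B∪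
      ... | inj₁ x∈B = Equivalence.from (white x) (there x∈) x∈B
      ... | inj₂ refl = All.lookup w∉ x∈ refl

  -- Propagation may run ahead of the schedule, so the invariant only includes the white vertices
  -- among the remaining targets. By monotonicity, a scheduled force whose target is still white is
  -- valid.
  Schedule⇒blueBy : ∀ {B F Ls} → Schedule G R Ls → (∀ {φ} → φ List.∈ concat Ls → φ List.∈ F) →
    ∀ s → (∀ {x} → x ∉ blueBy G R B F s → x List.∈ whites G Ls) →
    ∀ x → x ∈ blueBy G R B F (length Ls + s)
  Schedule⇒blueBy [] _ s white x = decidable-stable (x ∈? _) λ x∉ → case white x∉ of λ ()
  Schedule⇒blueBy {B} {F} {L ∷ Ls} (Φ ∷ sched) Ls⊆F s white x =
    subst (λ t → x ∈ blueBy G R B F t) (ℕ.+-suc (length Ls) s)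
      (Schedule⇒blueBy sched (Ls⊆F ∘ ∈-++⁺ʳ L) (suc s) white′ x)
    where
    blue = blueBy G R B F s
    white′ : ∀ {y} → y ∉ blueBy G R B F (suc s) → y List.∈ whites G Ls
    white′ {y} y∉
      with (u , _) , φ∈ , refl ← ∈-map⁻ proj₂ (white (y∉ ∘ p⊆p∪q _))
      with ∈-++⁻ L φ∈
    ... | inj₂ φ∈Ls = ∈-map⁺ proj₂ φ∈Ls
    ... | inj₁ φ∈L = contradiction
          (q⊆p∪q blue _ (Equivalence.from (∈-⟦⟧ (forced? G R B F blue) y)
            (u , Ls⊆F φ∈ ,
             Forces⇒CanForce G R (Forces-mono white (y∉ ∘ p⊆p∪q _) (All.lookup Φ φ∈L)))))
          y∉

  EfficientSchedule⇒th : ∀ {e} → EfficientSchedule G R e → th R G + e ≤ order G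
  EfficientSchedule⇒th {e} E = decidable-stable (_ ≤? _) λ ¬goal →
    -- First the least time `s` for this set of forces, then the least time `t` over all sets of
    -- forces of `B`; hence `t ≤ s ≤ length layers`.
    ¬¬-least (length layers) allBlue λ (s , s-least@(_ , s≤)) →
    ¬¬-least s (concat layers , chronological , s-least) λ (t , t-least@(_ , t≤)) →
    ¬goal (begin
      th R G + e                        ≤⟨ ℕ.+-monoˡ-≤ e (proj₂ (th-isThrottling R G) _
                                             (B , t , t-least , refl)) ⟩
      ∣ B ∣ + t + e                     ≡⟨ ℕ.+-assoc ∣ B ∣ t e ⟩
      ∣ B ∣ + (t + e)                   ≤⟨ ℕ.+-monoʳ-≤ ∣ B ∣ (ℕ.+-monoˡ-≤ e
                                             (ℕ.≤-trans (t≤ s (_ , chronological , s-least))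
                                                        (s≤ (length layers) allBlue))) ⟩
      ∣ B ∣ + (length layers + e)       ≤⟨ ℕ.+-monoʳ-≤ ∣ B ∣ saving ⟩
      ∣ B ∣ + length (concat layers)    ≡⟨ cong (∣ B ∣ +_) (length-map proj₂ (concat layers)) ⟨
      ∣ B ∣ + length (whites G layers)  ≤⟨ ∣p∣+length≤n B unique
                                             (λ {x} → Equivalence.from (white x)) ⟩
      order G                           ∎)
    where
    open EfficientSchedule E
    open ℕ.≤-Reasoning
    white? = λ x → ListDec._∈?_ Fin._≟_ x (whites G layers)
    B = ⟦ ¬? ∘ white? ⟧
    white : ∀ x → x ∉ B ⇔ x List.∈ whites G layers
    white x = mk⇔
      (λ x∉ → decidable-stable (white? x) (x∉ ∘ Equivalence.from (∈-⟦⟧ (¬? ∘ white?) x)))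
      (λ x∈ x∈B → Equivalence.to (∈-⟦⟧ (¬? ∘ white?) x) x∈B x∈)
    chronological = Schedule⇒Chronological schedule unique white
    allBlue : blueBy G R B (concat layers) (length layers) ≡ ⊤
    allBlue = ⊆-antisym (⊆-max _) λ {x} _ →
      subst (λ t → x ∈ blueBy G R B (concat layers) t) (ℕ.+-identityʳ (length layers))
        (Schedule⇒blueBy schedule id 0 (λ {x} → Equivalence.to (white x)) x)

  -- From throttling numbers to schedules.

  -- The new layer picks one forcer for each vertex that turns blue in step `suc i`; this keeps the
  -- targets distinct even if `F` offers several forcers.
  Schedule-prepend : ∀ B F i {Ls} → Schedule G R Ls → Unique (whites G Ls) →
    (∀ x → x ∉ blueBy G R B F (suc i) ⇔ x List.∈ whites G Ls) →
    ∃[ L ] Schedule G R (L ∷ Ls) × Unique (whites G (L ∷ Ls)) ×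
           (∀ x → x ∉ blueBy G R B F i ⇔ x List.∈ whites G (L ∷ Ls))
  Schedule-prepend B F i {Ls} sched unique white =
    let
      zs , eq = unmap (proj₂ ∘ proj₁) forcers
      L = map proj₁ zs
      whites≡ : whites G (L ∷ Ls) ≡ new ++ whites G Ls
      whites≡ = trans (map-++ proj₂ L (concat Ls))
        (cong (_++ whites G Ls) (trans (sym (map-∘ zs)) eq))
      white′ : ∀ x → x ∉ now ⇔ x List.∈ whites G (L ∷ Ls)
      white′ x = subst (λ ws → x ∉ now ⇔ x List.∈ ws) (sym whites≡)
        (mk⇔ (to x) (from x))
    in
    L ,
    All.map⁺ (All.universal (λ (_ , φ) → Forces-mono (λ {x} → Equivalence.from (white′ x))
      (Equivalence.to (white′ _) (Forces.white φ)) φ) zs) ∷ sched ,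
    subst Unique (sym whites≡)
      (Unique.++⁺ (Unique.filter⁺ new? (Unique.allFin⁺ (order G))) unique
        λ (x∈new , x∈Ls) → Equivalence.from (white _) x∈Ls (new⊆later x∈new)) ,
    white′
    where
    now   = blueBy G R B F i
    later = blueBy G R B F (suc i)
    next  = layer G R B F (suc i)
    new?  = λ x → ¬? (x ∈? now) ×-dec (x ∈? next)
    new   = filter new? (allFin (order G))

    forcers : All (λ w → ∃[ (φ , _) ] proj₂ φ ≡ w) new
    forcers = All.map
      (λ {w} (_ , w∈next) →
        let u , _ , can = Equivalence.to (∈-⟦⟧ (forced? G R B F now) w) w∈next in
        ((u , w) , CanForce⇒Forces G R can) , refl)
      (All.all-filter new? (allFin (order G)))

    new⊆later : ∀ {x} → x List.∈ new → x ∈ later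
    new⊆later x∈ = q⊆p∪q now next (proj₂ (proj₂ (∈-filter⁻ new? {xs = allFin _} x∈)))

    to : ∀ x → x ∉ now → x List.∈ new ++ whites G Ls
    to x x∉ with x ∈? next
    ... | yes x∈next = ∈-++⁺ˡ (∈-filter⁺ new? (∈-allFin x) (x∉ , x∈next))
    ... | no x∉next = ∈-++⁺ʳ new (Equivalence.to (white x)
          ([ x∉ , x∉next ]′ ∘ x∈p∪q⁻ now next))

    from : ∀ x → x List.∈ new ++ whites G Ls → x ∉ now
    from x x∈ with ∈-++⁻ new x∈
    ... | inj₁ x∈new = proj₁ (proj₂ (∈-filter⁻ new? {xs = allFin _} x∈new))
    ... | inj₂ x∈Ls = Equivalence.from (white x) x∈Ls ∘ p⊆p∪q next

  -- Built backwards from time `d + i`, when everything is blue, with one possibly empty layer per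
  -- step.
  blueBy⇒Schedule : ∀ B F d i → blueBy G R B F (d + i) ≡ ⊤ →
    ∃[ Ls ] Schedule G R Ls × Unique (whites G Ls) × length Ls ≡ d ×
            (∀ x → x ∉ blueBy G R B F i ⇔ x List.∈ whites G Ls)
  blueBy⇒Schedule B F zero i full = [] , [] , [] , refl ,
    λ x → mk⇔ (contradiction (subst (x ∈_) (sym full) ∈⊤)) λ ()
  blueBy⇒Schedule B F (suc d) i full
    with Ls , sched , unique , refl , white ← blueBy⇒Schedule B F d (suc i)
           (subst (λ t → blueBy G R B F t ≡ ⊤) (sym (ℕ.+-suc d i)) full)
    with L , sched′ , unique′ , white′ ← Schedule-prepend B F i sched unique white =
    L ∷ Ls , sched′ , unique′ , refl , white′

  th⇒EfficientSchedule : ∀ {e} → th R G + e ≤ order G → EfficientSchedule G R e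
  th⇒EfficientSchedule {e} h
    with B , s , ((F , _ , full , _) , _) , eq ← proj₁ (th-isThrottling R G)
    with Ls , sched , unique , refl , white ← blueBy⇒Schedule B F s 0
           (subst (λ t → blueBy G R B F t ≡ ⊤) (sym (ℕ.+-identityʳ s)) full) =
    record { layers = Ls ; schedule = sched ; unique = unique
           -- The targets cover the complement of `B`, and `∣ B ∣ + length Ls` is the throttling
           -- number, so `∣ B ∣` cancels.
           ; saving = ℕ.+-cancelˡ-≤ ∣ B ∣ _ _ (begin
      ∣ B ∣ + (length Ls + e)       ≡⟨ ℕ.+-assoc ∣ B ∣ (length Ls) e ⟨
      ∣ B ∣ + length Ls + e         ≡⟨ cong (_+ e) eq ⟩
      th R G + e                    ≤⟨ h ⟩
      order G                       ≤⟨ n≤∣p∣+length B (whites G Ls)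
                                         (λ {x} → Equivalence.to (white x)) ⟩
      ∣ B ∣ + length (whites G Ls)  ≡⟨ cong (∣ B ∣ +_) (length-map proj₂ (concat Ls)) ⟩
      ∣ B ∣ + length (concat Ls)    ∎) }
    where open ℕ.≤-Reasoning

-- Enumeration of the graphs of bounded order.

-- An entry is kept if its transpose is set and both its diagonal entries are clear:
-- this makes every matrix a graph and leaves adjacency matrices of graphs unchanged.
fromMatrix : ∀ {m} → Vec (Vec Bool m) m → Graph
fromMatrix {m} M = record
  { order = m
  ; adj = λ u v → (M [ u , v ] ∧ M [ v , u ]) ∧ not (M [ u , u ] ∨ M [ v , v ])
  ; symmetric = λ u v → cong₂ _∧_ (Bool.∧-comm (M [ u , v ]) _)
                                  (cong not (Bool.∨-comm (M [ u , u ]) _))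
  ; irreflexive = λ u → noLoop (M [ u , u ]) }
  where
  _[_,_] : Vec (Vec Bool m) m → Fin m → Fin m → Bool
  M [ u , v ] = Vec.lookup (Vec.lookup M u) v
  noLoop : ∀ b → (b ∧ b) ∧ not (b ∨ b) ≡ false
  noLoop false = refl
  noLoop true  = refl

adjacencyMatrix : (G : Graph) → Vec (Vec Bool (order G)) (order G)
adjacencyMatrix G = Vec.tabulate λ u → Vec.tabulate (Graph.adj G u)

lookup-adjacencyMatrix : ∀ G u v →
  Vec.lookup (Vec.lookup (adjacencyMatrix G) u) v ≡ Graph.adj G u v
lookup-adjacencyMatrix G u v =
  trans (cong (λ r → Vec.lookup r v) (Vec.lookup∘tabulate _ u)) (Vec.lookup∘tabulate _ v)

fromMatrix-adjacencyMatrix : ∀ G u v →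
  Graph.adj (fromMatrix (adjacencyMatrix G)) u v ≡ Graph.adj G u v
fromMatrix-adjacencyMatrix G u v
  rewrite lookup-adjacencyMatrix G u v | lookup-adjacencyMatrix G v u
        | lookup-adjacencyMatrix G u u | lookup-adjacencyMatrix G v v
        | Graph.symmetric G v u | Graph.irreflexive G u | Graph.irreflexive G v
        | Bool.∧-idem (Graph.adj G u v) = Bool.∧-identityʳ _

graphsOfOrder : ℕ → List Graph
graphsOfOrder m = map fromMatrix (vectors (vectors (false ∷ true ∷ []) m) m)

graphsUpTo : ℕ → List Graph
graphsUpTo N = concatMap graphsOfOrder (upTo (suc N))

-- The list contains a copy of `G` with pointwise equal adjacency, rather than the record `G`
-- itself.
∈-graphsUpTo : ∀ {N} G → order G ≤ N → fromMatrix (adjacencyMatrix G) List.∈ graphsUpTo N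
∈-graphsUpTo G n≤N = ∈-concatMap⁺ graphsOfOrder (lose (∈-upTo⁺ (s≤s n≤N))
  (∈-map⁺ fromMatrix (∈-vectors (∈-vectors ∈-bools) (adjacencyMatrix G))))
  where
  ∈-bools : ∀ b → b List.∈ false ∷ true ∷ []
  ∈-bools false = here refl
  ∈-bools true  = there (here refl)

theorem4p7 : ∀ (k : ℕ) (R : Rule) →
    Σ[ 𝒢 ∈ List Graph ] (∀ (G : Graph) → k ≤ order G →
    (th R G ≥ order G ∸ k) ⇔ (¬ Any (λ H → H InducedIn G) 𝒢))
theorem4p7 k R = filter efficient? candidates , λ G k≤n → mk⇔
  (λ n∸k≤th any → case find any of λ (H , H∈ , f , inj , adj≡) →
    ℕ.≤⇒≯ n∸k≤th (<-∸ G (EfficientSchedule⇒th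
      (EfficientSchedule-extend {H} {G} R inj adj≡
        (th⇒EfficientSchedule (proj₂ (∈-filter⁻ efficient? {xs = candidates} H∈)))))))
  (λ ∄ → ℕ.≮⇒≥ λ th<n∸k →
    let H , small , (f , inj , adj≡) , E =
          small-support (th⇒EfficientSchedule {G} {R} {e} (<-∸⁻ G k≤n th<n∸k))
        H′ = fromMatrix (adjacencyMatrix H)
        H′≡H = fromMatrix-adjacencyMatrix H
        -- The family consists of graphs built from matrices, so the saving is moved along the
        -- identity map to the copy `H′`.
        E′ = EfficientSchedule-extend {H} {H′} R id (λ u v → sym (H′≡H u v)) E
    in ∄ (lose (∈-filter⁺ efficient? (∈-graphsUpTo H small) (EfficientSchedule⇒th E′))
               (f , (λ {x} {y} → inj {x} {y}) , λ u v → trans (H′≡H u v) (adj≡ u v))))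
  where
  -- Failure of the bound means `th R G < order G ∸ k`, that is, a saving of at least `suc k`.
  e = suc k
  efficient? = λ H → th R H + e ≤? order H
  -- The order bound is the one from `small-support`.
  candidates = graphsUpTo ((e + e) + (e + e))
  <-∸ : ∀ G → th R G + e ≤ order G → th R G < order G ∸ k
  <-∸ G h = ℕ.m+n≤o⇒m≤o∸n (suc (th R G)) (subst (_≤ order G) (ℕ.+-suc (th R G) k) h)
  <-∸⁻ : ∀ G → k ≤ order G → th R G < order G ∸ k → th R G + e ≤ order G
  <-∸⁻ G k≤n h = subst (_≤ order G) (sym (ℕ.+-suc (th R G) k))
    (ℕ.m≤o∸n⇒m+n≤o (suc (th R G)) k≤n h)
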